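{- Consider an instance of the submodular partition problem (notation in context) with $m\ge 2$ users, and let $G=\{(u_1,r_1),\dots,(u_n,r_n)\}$ be the output of the GREEDY-M algorithm, where $(u_i,r_i)$ is the pair chosen at iteration $i$, $d_i^p$ the discriminant at iteration $i$ and $c_{u_i}$ the curvature of $Z_{u_i}$. Let $\Omega$ be an optimal partition and assume $Z(\Omega)>0$. Then $$\frac{Z(G)}{Z(\Omega)}\ \ge\ \min\left(1,\ \frac{1}{\max_{1\le i\le n}\left\{c_{u_i}+\frac{1}{d_i^p}\right\}}\right),$$ with the conventions $1/\infty=0$, $1/0=\infty$.
   Context: Submodular partition problem: a finite set of resources $\mathcal{R}$ with $|\mathcal{R}|=n$ and a finite set of users $\mathcal{U}$ with $|\mathcal{U}|=m$; each user $u$ has a monotone submodular $Z_u:2^{\mathcal{R}}\to\mathbb{R}$ with $Z_u(\emptyset)=0$ (monotone: $Z_u(S)\le Z_u(T)$ for $S\subseteq T$; submodular: $Z_u(T\cup\{x\})-Z_u(T)\le Z_u(S\cup\{x\})-Z_u(S)$ for $S\subseteq T$, $x\notin T$). Let $\mathcal{V}=\mathcal{U}\times\mathcal{R}$; for $S\subseteq\mathcal{V}$ let $S_u=\{r:(u,r)\in S\}$ and $Z(S)=\sum_{u\in\mathcal{U}}Z_u(S_u)$. An allocation is $S\subseteq \mathcal{V}$ in which each resource appears in at most one pair; a partition is an allocation in which every resource appears in exactly one pair. $\Omega$ is a partition maximizing $Z$. For $S\subseteq\mathcal{V}$, $\rho^u_r(S)=Z_u(S_u\cup\{r\})-Z_u(S_u)$.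 The curvature of $Z_u$ is $c_u=1-\min\{(Z_u(S\cup\{r\})-Z_u(S))/Z_u(\{r\}): S\subseteq\mathcal{R},\ r\in\mathcal{R}\setminus S,\ Z_u(\{r\})>0\}$. GREEDY-M algorithm: $G^0=\emptyset$; for $i=1,\dots,n$, among pairs $(u,r)$ with $r$ not allocated in $G^{i-1}$, select a pair maximizing $\rho^u_r(G^{i-1})$; if several pairs attain the maximum, select among them one minimizing $c_u+1/d_i(u,r)$, where $d_i(u,r)=\rho^u_r(G^{i-1})/\max_{u'\neq u}\rho^{u'}_r(G^{i-1})$ (set to $\infty$ if the denominator is $0$); remaining ties are broken by a fixed index order of pairs. Call the selected pair $(u_i,r_i)$ and set $G^i=G^{i-1}\cup\{(u_i,r_i)\}$; output $G=G^n$. The discriminant at iteration $i$ is $d_i^p=d_i(u_i,r_i)$. -}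

module Defs where

open import Algebra.Bundles using (CommutativeRing)
open import Data.Fin using (Fin; _≟_)
open import Data.Fin.Subset using (Subset; inside; outside; ⊥; ⁅_⁆; _∪_; _∈_; _∉_; _⊆_)
open import Data.Fin.Subset.Properties using (_∈?_)
open import Data.List using (List; []; _∷_; _++_; map; filter; allFin; cartesianProduct)
open import Data.Nat as ℕ using (ℕ; zero; suc)
open import Data.Product using (_×_; _,_; ∃)
open import Data.Vec using (Vec; []; _∷_)
open import Data.Vec.Functional using (Vector; updateAt)
open import Function.Bundles using (_↣_; Injection)
open import Level using (Level; _⊔_) renaming (suc to lsuc)
open import Relation.Binary.Bundles using (TotalOrder)
open import Relation.Binary.Core using (Rel)
open import Relation.Binary.PropositionalEquality using (_≡_)
open import Relation.Binary.Structures using (IsDecTotalOrder)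
open import Relation.Nullary using (¬_; Dec; yes; no; ¬?; _×-dec_)
open import Relation.Nullary.Construct.Add.Supremum using (_⁺; [_]; ⊤⁺)

import Algebra.Construct.NaturalChoice.Min as Min
import Algebra.Properties.CommutativeMonoid.Sum as Sum
import Data.List.Extrema as Extrema
import Relation.Binary.Construct.Add.Supremum.NonStrict as AddSupremum
import Relation.Binary.Construct.NonStrictToStrict as ToStrict

-- The real numbers enter only through their structure as a linearly ordered
-- field.  The inverse is a total function, unconstrained at 0#.

record LinearlyOrderedField (a ℓ₁ ℓ₂ : Level) : Set (lsuc (a ⊔ ℓ₁ ⊔ ℓ₂)) where
  infix  4 _≤_
  infix  8 _⁻¹
  field
    commutativeRing : CommutativeRing a ℓ₁

  open CommutativeRing commutativeRing public

  field
    _≤_             : Rel Carrier ℓ₂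
    isDecTotalOrder : IsDecTotalOrder _≈_ _≤_
    +-monoˡ-≤       : ∀ z {x y} → x ≤ y → x + z ≤ y + z
    *-nonNegative   : ∀ {x y} → 0# ≤ x → 0# ≤ y → 0# ≤ x * y
    0≉1             : ¬ 0# ≈ 1#
    _⁻¹             : Carrier → Carrier
    ⁻¹-inverseʳ     : ∀ {x} → ¬ x ≈ 0# → x * x ⁻¹ ≈ 1#

  infixl 7 _/_
  _/_ : Carrier → Carrier → Carrier
  x / y = x * y ⁻¹

module _ {a ℓ₁ ℓ₂} (O : TotalOrder a ℓ₁ ℓ₂) where
  open TotalOrder O using (Carrier)
  open Extrema O using (min; max)

  -- The first argument is the value at the empty list only.
  minimumOr maximumOr : Carrier → List Carrier → Carrier
  minimumOr e []       = e
  minimumOr e (x ∷ xs) = min x xs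
  maximumOr e []       = e
  maximumOr e (x ∷ xs) = max x xs

allSubsets : ∀ n → List (Subset n)
allSubsets zero    = [] ∷ []
allSubsets (suc n) = map (outside ∷_) (allSubsets n) ++ map (inside ∷_) (allSubsets n)

module SubmodularPartition {a ℓ₁ ℓ₂} (F : LinearlyOrderedField a ℓ₁ ℓ₂) where
  open LinearlyOrderedField F
  module ≤ = IsDecTotalOrder isDecTotalOrder
  open ToStrict _≈_ _≤_ public using (_<_)
  open Sum +-commutativeMonoid using (sum)

  ≤-totalOrder : TotalOrder a ℓ₁ ℓ₂
  ≤-totalOrder = record { isTotalOrder = ≤.isTotalOrder }

  _<?_ : ∀ x y → Dec (x < y)
  _<?_ = ToStrict.<-decidable _≈_ _≤_ ≤._≟_ ≤._≤?_

  -- Carrier ⁺ is the field with ∞ = ⊤⁺ adjoined as top element.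

  open AddSupremum _≤_ public using (_≤⁺_; ≤⁺-isTotalOrder)

  ≤⁺-totalOrder : TotalOrder a (a ⊔ ℓ₁) (a ⊔ ℓ₂)
  ≤⁺-totalOrder = record { isTotalOrder = ≤⁺-isTotalOrder ≤.isTotalOrder }

  open Min ≤⁺-totalOrder public using () renaming (_⊓_ to _⊓⁺_)

  infix 8 1/⁺_
  1/⁺_ : Carrier ⁺ → Carrier ⁺
  1/⁺ ⊤⁺ = [ 0# ]
  1/⁺ [ x ] with x ≤.≟ 0#
  ... | yes _ = ⊤⁺
  ... | no  _ = [ x ⁻¹ ]

  infixl 6 _+⁺_
  _+⁺_ : Carrier → Carrier ⁺ → Carrier ⁺
  x +⁺ ⊤⁺    = ⊤⁺
  x +⁺ [ y ] = [ x + y ]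

  Monotone : ∀ {n} → (Subset n → Carrier) → Set ℓ₂
  Monotone f = ∀ S T → S ⊆ T → f S ≤ f T

  Submodular : ∀ {n} → (Subset n → Carrier) → Set ℓ₂
  Submodular f = ∀ S T x → S ⊆ T → x ∉ T →
    f (T ∪ ⁅ x ⁆) - f T ≤ f (S ∪ ⁅ x ⁆) - f S

  -- The minimum ranges over the empty family exactly when no singleton has
  -- positive value, i.e. when a normalised monotone submodular f vanishes
  -- identically; its curvature is then 1 - 1, that of a modular function.
  curvature : ∀ {n} → (Subset n → Carrier) → Carrier
  curvature {n} f = 1# - minimumOr ≤-totalOrder 1#
    (map ratio (filter admissible? (cartesianProduct (allSubsets n) (allFin n))))
    where
    ratio : Subset n × Fin n → Carrier
    ratio (S , r) = (f (S ∪ ⁅ r ⁆) - f S) / f ⁅ r ⁆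

    admissible? : (p : Subset n × Fin n) → let (S , r) = p in Dec (r ∉ S × 0# < f ⁅ r ⁆)
    admissible? (S , r) = ¬? (r ∈? S) ×-dec (0# <? f ⁅ r ⁆)

  record Instance (m n : ℕ) : Set (a ⊔ ℓ₁ ⊔ ℓ₂) where
    field
      value      : Fin m → Subset n → Carrier
      monotone   : ∀ u → Monotone (value u)
      submodular : ∀ u → Submodular (value u)
      normalised : ∀ u → value u ⊥ ≈ 0#

  -- A set S ⊆ 𝒰 × ℛ is given by its sections: r ∈ S u stands for (u , r) ∈ S.
  PairSet : ℕ → ℕ → Set
  PairSet m n = Vector (Subset n) m

  ∅ : ∀ {m n} → PairSet m n
  ∅ _ = ⊥

  insert : ∀ {m n} → Fin m × Fin n → PairSet m n → PairSet m n
  insert (u , r) S = updateAt S u (_∪ ⁅ r ⁆)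

  IsAllocation : ∀ {m n} → PairSet m n → Set
  IsAllocation S = ∀ {u v r} → r ∈ S u → r ∈ S v → u ≡ v

  IsPartition : ∀ {m n} → PairSet m n → Set
  IsPartition S = IsAllocation S × (∀ r → ∃ λ u → r ∈ S u)

  module _ {m n : ℕ} (I : Instance m n) where
    open Instance I

    Z : PairSet m n → Carrier
    Z S = sum (λ u → value u (S u))

    IsOptimalPartition : PairSet m n → Set ℓ₂
    IsOptimalPartition Ω = IsPartition Ω × (∀ P → IsPartition P → Z P ≤ Z Ω)

    ρ : Fin m × Fin n → PairSet m n → Carrier
    ρ (u , r) S = value u (S u ∪ ⁅ r ⁆) - value u (S u)

    -- For m ≥ 2 the list of rivals is nonempty and 0# is never used.
    bestRival : Fin m × Fin n → PairSet m n → Carrier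
    bestRival (u , r) S = maximumOr ≤-totalOrder 0#
      (map (λ v → ρ (v , r) S) (filter (λ v → ¬? (v ≟ u)) (allFin m)))

    discriminant : Fin m × Fin n → PairSet m n → Carrier ⁺
    discriminant p S with bestRival p S ≤.≟ 0#
    ... | yes _ = ⊤⁺
    ... | no  _ = [ ρ p S / bestRival p S ]

    score : Fin m × Fin n → PairSet m n → Carrier ⁺
    score (u , r) S = curvature (value u) +⁺ 1/⁺ discriminant (u , r) S

    Available : PairSet m n → Fin m × Fin n → Set
    Available S (_ , r) = ∀ v → r ∉ S v

    MaximalGain : PairSet m n → Fin m × Fin n → Set ℓ₂
    MaximalGain S p = Available S p × (∀ q → Available S q → ρ q S ≤ ρ p S)

    MinimalScore : PairSet m n → Fin m × Fin n → Set (a ⊔ ℓ₂)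
    MinimalScore S p = MaximalGain S p × (∀ q → MaximalGain S q → score p S ≤⁺ score q S)

    -- The fixed order of pairs is the one induced by an injective numbering.
    Selected : (Fin m × Fin n) ↣ ℕ → PairSet m n → Fin m × Fin n → Set (a ⊔ ℓ₂)
    Selected index S p =
      MinimalScore S p × (∀ q → MinimalScore S q → Injection.to index p ℕ.≤ Injection.to index q)

    -- Histories list the chosen pairs with the most recent one first.
    chosen : ∀ {k} → Vec (Fin m × Fin n) k → PairSet m n
    chosen []       = ∅
    chosen (p ∷ ps) = insert p (chosen ps)

    data GreedyM (index : (Fin m × Fin n) ↣ ℕ) : ∀ {k} → Vec (Fin m × Fin n) k → Set (a ⊔ ℓ₂) where
      start  : GreedyM index []
      select : ∀ {k p} {ps : Vec (Fin m × Fin n) k} →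
               GreedyM index ps → Selected index (chosen ps) p → GreedyM index (p ∷ ps)

    -- The values c_{uᵢ} + 1/dᵢᵖ, each dᵢᵖ being taken at the state before pair i is added.
    scores : ∀ {k} → Vec (Fin m × Fin n) k → List (Carrier ⁺)
    scores []       = []
    scores (p ∷ ps) = score p (chosen ps) ∷ scores ps

    -- [ 0# ] is the value at the empty history only.
    maxScore : ∀ {k} → Vec (Fin m × Fin n) k → Carrier ⁺
    maxScore ps = maximumOr ≤⁺-totalOrder [ 0# ] (scores ps)

{-# OPTIONS --safe #-}
module Submission where

-- Transform Ω into G by reassigning r₁, …, rₙ in turn, giving rᵢ to uᵢ.  Write
-- H for the partition before step i; it contains G^{i-1}.  If rᵢ was owned by
-- v ≠ uᵢ, submodularity bounds the loss of v by ρ^v_{rᵢ}(G^{i-1}), hence by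
-- ρᵢ/dᵢ, while the curvature of Z_{uᵢ} makes the gain of uᵢ at least
-- (1 - c_{uᵢ}) Z_{uᵢ}({rᵢ}) ≥ (1 - c_{uᵢ}) ρᵢ.  So Z drops by at most
-- (c_{uᵢ} + 1/dᵢ - 1) ρᵢ, and by 0 if v = uᵢ.  As Z(G) is the sum of the ρᵢ,
-- Z(Ω) ≤ (1 + s) Z(G) for every s ≥ 0 with c_{uᵢ} + 1/dᵢ ≤ 1 + s for all i.

open import Defs
open import Data.Fin using (Fin; _≟_; punchIn) renaming (zero to fzero; suc to fsuc)
open import Data.Fin.Properties using (any?; injective⇒≤; punchInᵢ≢i)
open import Data.Fin.Subset using (Subset; inside; outside; ⊥; ⁅_⁆; _∪_; _─_; _∈_; _∉_; _⊆_)
open import Data.Fin.Subset.Properties using (_∈?_; x∈⁅x⁆; x∈⁅y⁆⇒x≡y; x≢y⇒x∉⁅y⁆; ∉⊥; ⊥⊆; p⊆p∪q; x∈p∪q⁺; x∈p∪q⁻; ∪-identityˡ; p─q⊆p; p─q─q≡p─q; x∈p∧x∉q⇒x∈p─q; x∈p⇒p-x⊂p; ⊂-irref)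
open import Data.List using (List; []; _∷_; map; filter; allFin; cartesianProduct)
open import Data.List.Membership.Propositional using () renaming (_∈_ to _∈ˡ_)
open import Data.List.Membership.Propositional.Properties using (∈-++⁺ˡ; ∈-++⁺ʳ; ∈-map⁺; ∈-filter⁺; ∈-cartesianProduct⁺; ∈-allFin)
open import Data.List.Relation.Unary.All as All using (All; []; _∷_)
open import Data.List.Relation.Unary.All.Properties using (all-filter) renaming (map⁺ to All-map⁺)
open import Data.List.Relation.Unary.Any using (here; there)
open import Data.Nat as ℕ using (ℕ; suc)
open import Data.Nat.Properties using (1+n≰n)
open import Data.Product using (_×_; _,_; ∃; proj₁; proj₂)
open import Data.Sum using (_⊎_; inj₁; inj₂)
open import Data.Vec as Vec using (Vec; []; _∷_)
open import Data.Vec.Functional using (Vector; removeAt)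
open import Data.Vec.Functional.Properties using (updateAt-updates; updateAt-minimal)
open import Data.Vec.Relation.Unary.All as VecAll using ([]; _∷_)
open import Data.Vec.Relation.Unary.AllPairs using ([]; _∷_)
open import Data.Vec.Relation.Unary.Unique.Propositional using (Unique)
open import Data.Vec.Relation.Unary.Unique.Propositional.Properties using (lookup-injective)
open import Function using (_∘_)
open import Function.Bundles using (_↣_)
open import Relation.Binary.Bundles using (Poset; TotalOrder)
open import Relation.Binary.PropositionalEquality as ≡ using (_≡_; _≢_)
open import Relation.Nullary using (¬_; Dec; yes; no; ¬?; _×-dec_; contradiction)
open import Relation.Nullary.Construct.Add.Supremum using ([_]; ⊤⁺)

import Algebra.Construct.NaturalChoice.Min as Min
import Algebra.Construct.NaturalChoice.MinOp as MinOp
import Algebra.Properties.CommutativeMonoid.Sum as Sum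
import Algebra.Properties.Group as GroupProperties
import Algebra.Properties.Ring as RingProperties
import Algebra.Solver.Ring.NaturalCoefficients.Default as SemiringSolver
import Data.List.Extrema as Extrema
import Relation.Binary.Construct.Add.Supremum.NonStrict as AddSupremum
import Relation.Binary.Reasoning.PartialOrder as PosetReasoning

-- Finite subsets and their enumeration.

x∉p─⁅x⁆ : ∀ {n} (p : Subset n) {x} → x ∉ p ─ ⁅ x ⁆
x∉p─⁅x⁆ p {x} x∈p─x = ⊂-irref (p─q─q≡p─q p ⁅ x ⁆) (x∈p⇒p-x⊂p x∈p─x)

r∉p∧p⊆q⇒p⊆q─⁅r⁆ : ∀ {n r} {p q : Subset n} → r ∉ p → p ⊆ q → p ⊆ q ─ ⁅ r ⁆
r∉p∧p⊆q⇒p⊆q─⁅r⁆ {r = r} {p} r∉p p⊆q x∈p =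
  x∈p∧x∉q⇒x∈p─q (p⊆q x∈p) (λ x∈r → r∉p (≡.subst (_∈ p) (x∈⁅y⁆⇒x≡y r x∈r) x∈p))

p⊆p─⁅r⁆∪⁅r⁆ : ∀ {n} (p : Subset n) r → p ⊆ (p ─ ⁅ r ⁆) ∪ ⁅ r ⁆
p⊆p─⁅r⁆∪⁅r⁆ p r {x} x∈p with x ≟ r
... | yes ≡.refl = x∈p∪q⁺ (inj₂ (x∈⁅x⁆ r))
... | no x≢r     = x∈p∪q⁺ (inj₁ (x∈p∧x∉q⇒x∈p─q x∈p (x≢y⇒x∉⁅y⁆ x≢r)))

∈-allSubsets : ∀ {n} (S : Subset n) → S ∈ˡ allSubsets n
∈-allSubsets []            = here ≡.refl
∈-allSubsets (outside ∷ S) = ∈-++⁺ˡ (∈-map⁺ (outside ∷_) (∈-allSubsets S))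
∈-allSubsets (inside  ∷ S) = ∈-++⁺ʳ _ (∈-map⁺ (inside ∷_) (∈-allSubsets S))

-- Pigeonhole principle, used to show that the greedy picks exhaust the resources.
¬Unique-suc : ∀ {n} {xs : Vec (Fin n) (suc n)} → ¬ Unique xs
¬Unique-suc xs! = 1+n≰n (injective⇒≤ (lookup-injective xs! _ _))

-- Extrema of lists.

module _ {a ℓ₁ ℓ₂} (O : TotalOrder a ℓ₁ ℓ₂) where
  open TotalOrder O
  open Extrema O

  minimumOr-≤ : ∀ e {x xs} → x ∈ˡ xs → minimumOr O e xs ≤ x
  minimumOr-≤ e {xs = y ∷ ys} (here ≡.refl) = min≤⊤ y ys
  minimumOr-≤ e {xs = y ∷ ys} (there x∈ys)  = All.lookup (min≤xs y ys) x∈ys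

  minimumOr-glb : ∀ {v e xs} → v ≤ e → All (v ≤_) xs → v ≤ minimumOr O e xs
  minimumOr-glb v≤e []            = v≤e
  minimumOr-glb v≤e (v≤x ∷ v≤xs)  = v≤min⁺ v≤x v≤xs

  ≤-maximumOr : ∀ e xs → All (_≤ maximumOr O e xs) xs
  ≤-maximumOr e []       = []
  ≤-maximumOr e (x ∷ xs) = ⊥≤max x xs ∷ xs≤max x xs

-- Inequalities in a linearly ordered field.

module OrderedFieldProperties {a ℓ₁ ℓ₂} (F : LinearlyOrderedField a ℓ₁ ℓ₂) where
  open LinearlyOrderedField F
  open SubmodularPartition F
  open Sum +-commutativeMonoid using (sum; sum-remove)
  open RingProperties ring using (-‿distribˡ-*; -‿involutive)
  open GroupProperties +-group using (//-rightDividesˡ; //-rightDividesʳ)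
  module Semiring = SemiringSolver commutativeSemiring
  open Semiring using (solve; _:+_; _:=_)

  ≤-poset : Poset a ℓ₁ ℓ₂
  ≤-poset = record { isPartialOrder = ≤.isPartialOrder }

  open PosetReasoning ≤-poset

  x-y+y≈x : ∀ x y → (x - y) + y ≈ x
  x-y+y≈x x y = //-rightDividesˡ y x

  x+y-y≈x : ∀ x y → (x + y) - y ≈ x
  x+y-y≈x x y = //-rightDividesʳ y x

  +-cancelʳ-≤ : ∀ z {x y} → x + z ≤ y + z → x ≤ y
  +-cancelʳ-≤ z {x} {y} x+z≤y+z = begin
    x            ≈⟨ x+y-y≈x x z ⟨
    (x + z) - z  ≤⟨ +-monoˡ-≤ (- z) x+z≤y+z ⟩
    (y + z) - z  ≈⟨ x+y-y≈x y z ⟩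
    y            ∎

  +-mono-≤ : ∀ {x y z w} → x ≤ y → z ≤ w → x + z ≤ y + w
  +-mono-≤ {x} {y} {z} {w} x≤y z≤w = begin
    x + z  ≤⟨ +-monoˡ-≤ z x≤y ⟩
    y + z  ≈⟨ +-comm y z ⟩
    z + y  ≤⟨ +-monoˡ-≤ y z≤w ⟩
    w + y  ≈⟨ +-comm w y ⟩
    y + w  ∎

  -- Lets a linear consequence be checked by a subtraction-free identity.
  ≤-transfer : ∀ {p q x y} → p ≤ q → x + q ≈ y + p → x ≤ y
  ≤-transfer {p} {q} {x} {y} p≤q x+q≈y+p = +-cancelʳ-≤ q (begin
    x + q  ≈⟨ x+q≈y+p ⟩
    y + p  ≤⟨ +-mono-≤ ≤.refl p≤q ⟩
    y + q  ∎)

  x≤y⇒0≤y-x : ∀ {x y} → x ≤ y → 0# ≤ y - x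
  x≤y⇒0≤y-x {x} {y} x≤y = +-cancelʳ-≤ x (begin
    0# + x       ≈⟨ +-identityˡ x ⟩
    x            ≤⟨ x≤y ⟩
    y            ≈⟨ x-y+y≈x y x ⟨
    (y - x) + x  ∎)

  x≤0⇒0≤-x : ∀ {x} → x ≤ 0# → 0# ≤ - x
  x≤0⇒0≤-x {x} x≤0 = ≤.≤-respʳ-≈ (+-identityˡ (- x)) (x≤y⇒0≤y-x x≤0)

  *-monoˡ-≤-nonNeg : ∀ {x y z} → 0# ≤ z → x ≤ y → z * x ≤ z * y
  *-monoˡ-≤-nonNeg {x} {y} {z} 0≤z x≤y = begin
    z * x                ≈⟨ +-identityˡ (z * x) ⟨
    0# + z * x           ≤⟨ +-monoˡ-≤ (z * x) (*-nonNegative 0≤z (x≤y⇒0≤y-x x≤y)) ⟩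
    z * (y - x) + z * x  ≈⟨ distribˡ z (y - x) x ⟨
    z * ((y - x) + x)    ≈⟨ *-congˡ (x-y+y≈x y x) ⟩
    z * y                ∎

  *-monoʳ-≤-nonNeg : ∀ {x y z} → 0# ≤ z → x ≤ y → x * z ≤ y * z
  *-monoʳ-≤-nonNeg {x} {y} {z} 0≤z x≤y = begin
    x * z  ≈⟨ *-comm x z ⟩
    z * x  ≤⟨ *-monoˡ-≤-nonNeg 0≤z x≤y ⟩
    z * y  ≈⟨ *-comm z y ⟩
    y * z  ∎

  0≤1 : 0# ≤ 1#
  0≤1 with ≤.total 0# 1#
  ... | inj₁ 0≤1 = 0≤1
  -- If 1 ≤ 0, then -1 is nonnegative, and so is its square, which is 1.
  ... | inj₂ 1≤0 = begin
    0#             ≤⟨ *-nonNegative (x≤0⇒0≤-x 1≤0) (x≤0⇒0≤-x 1≤0) ⟩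
    - 1# * - 1#    ≈⟨ -‿distribˡ-* 1# (- 1#) ⟨
    - (1# * - 1#)  ≈⟨ -‿cong (*-identityˡ (- 1#)) ⟩
    - (- 1#)       ≈⟨ -‿involutive 1# ⟩
    1#             ∎

  0<x⇒x≉0 : ∀ {x} → 0# < x → ¬ x ≈ 0#
  0<x⇒x≉0 (_ , 0≉x) x≈0 = 0≉x (sym x≈0)

  0<x⇒0≤x⁻¹ : ∀ {x} → 0# < x → 0# ≤ x ⁻¹
  0<x⇒0≤x⁻¹ {x} 0<x with ≤.total 0# (x ⁻¹)
  ... | inj₁ 0≤x⁻¹ = 0≤x⁻¹
  ... | inj₂ x⁻¹≤0 = contradiction (≤.antisym 0≤1 1≤0) 0≉1
    where
    1≤0 : 1# ≤ 0#
    1≤0 = begin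
      1#        ≈⟨ ⁻¹-inverseʳ (0<x⇒x≉0 0<x) ⟨
      x * x ⁻¹  ≤⟨ *-monoˡ-≤-nonNeg (proj₁ 0<x) x⁻¹≤0 ⟩
      x * 0#    ≈⟨ zeroʳ x ⟩
      0#        ∎

  x/y*y≈x : ∀ x {y} → ¬ y ≈ 0# → x / y * y ≈ x
  x/y*y≈x x {y} y≉0 = begin-equality
    x * y ⁻¹ * y    ≈⟨ *-assoc x (y ⁻¹) y ⟩
    x * (y ⁻¹ * y)  ≈⟨ *-congˡ (trans (*-comm (y ⁻¹) y) (⁻¹-inverseʳ y≉0)) ⟩
    x * 1#          ≈⟨ *-identityʳ x ⟩
    x               ∎

  x*z≤y⇒x≤y/z : ∀ {x y z} → 0# < z → x * z ≤ y → x ≤ y / z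
  x*z≤y⇒x≤y/z {x} {y} {z} 0<z x*z≤y = begin
    x               ≈⟨ *-identityʳ x ⟨
    x * 1#          ≈⟨ *-congˡ (⁻¹-inverseʳ (0<x⇒x≉0 0<z)) ⟨
    x * (z * z ⁻¹)  ≈⟨ *-assoc x z (z ⁻¹) ⟨
    x * z * z ⁻¹    ≤⟨ *-monoʳ-≤-nonNeg (0<x⇒0≤x⁻¹ 0<z) x*z≤y ⟩
    y * z ⁻¹        ∎

  x≤y*z⇒y⁻¹*x≤z : ∀ {x y z} → 0# < y → x ≤ y * z → y ⁻¹ * x ≤ z
  x≤y*z⇒y⁻¹*x≤z {x} {y} {z} 0<y x≤y*z = begin
    y ⁻¹ * x        ≤⟨ *-monoˡ-≤-nonNeg (0<x⇒0≤x⁻¹ 0<y) x≤y*z ⟩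
    y ⁻¹ * (y * z)  ≈⟨ *-assoc (y ⁻¹) y z ⟨
    y ⁻¹ * y * z    ≈⟨ *-congʳ (trans (*-comm (y ⁻¹) y) (⁻¹-inverseʳ (0<x⇒x≉0 0<y))) ⟩
    1# * z          ≈⟨ *-identityˡ z ⟩
    z               ∎

  sum-mono-≤ : ∀ {n} {f g : Vector Carrier n} → (∀ i → f i ≤ g i) → sum f ≤ sum g
  sum-mono-≤ {ℕ.zero} f≤g = ≤.refl
  sum-mono-≤ {suc n}  f≤g = +-mono-≤ (f≤g fzero) (sum-mono-≤ (f≤g ∘ fsuc))

  sum-nonNegative : ∀ {n} {f : Vector Carrier n} → (∀ i → 0# ≤ f i) → 0# ≤ sum f
  sum-nonNegative {ℕ.zero} 0≤f = ≤.refl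
  sum-nonNegative {suc n}  0≤f =
    ≤.≤-respˡ-≈ (+-identityˡ 0#) (+-mono-≤ (0≤f fzero) (sum-nonNegative (0≤f ∘ fsuc)))

  -- Adding the entries at `i` crosswise cancels that index, so nothing is asked of it. This
  -- isolates the one user whose section changes in an essential way.
  sum-mono-≤-except : ∀ {n} i {f g : Vector Carrier n} → (∀ j → j ≢ i → f j ≤ g j) →
                      sum f + g i ≤ sum g + f i
  sum-mono-≤-except {suc n} i {f} {g} f≤g = begin
    sum f + g i                       ≈⟨ +-congʳ (sum-remove {i = i} f) ⟩
    (f i + sum (removeAt f i)) + g i  ≤⟨ ≤-transfer (sum-mono-≤ (λ j → f≤g (punchIn i j) (punchInᵢ≢i i j)))
                                         (solve 4 (λ x y z w → ((x :+ y) :+ z) :+ w := ((z :+ w) :+ x) :+ y) refl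
                                           (f i) (sum (removeAt f i)) (g i) (sum (removeAt g i))) ⟩
    (g i + sum (removeAt g i)) + f i  ≈⟨ +-congʳ (sum-remove {i = i} g) ⟨
    sum g + f i                       ∎

module ExchangeArgument {a ℓ₁ ℓ₂} (F : LinearlyOrderedField a ℓ₁ ℓ₂) where
  open LinearlyOrderedField F
  open SubmodularPartition F
  open OrderedFieldProperties F
  open Semiring using (solve; _:+_; _:*_; _:=_)
  open AddSupremum _≤_ using ([_]; [≤]-injective)
  open PosetReasoning ≤-poset

  -- Marginals and curvature.

  module _ {n} (f : Subset n → Carrier) where

    marginal-nonNegative : Monotone f → ∀ S r → 0# ≤ f (S ∪ ⁅ r ⁆) - f S
    marginal-nonNegative mono S r = x≤y⇒0≤y-x (mono S (S ∪ ⁅ r ⁆) (p⊆p∪q ⁅ r ⁆))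

    marginal≤singleton : Submodular f → f ⊥ ≈ 0# → ∀ {S r} → r ∉ S → f (S ∪ ⁅ r ⁆) - f S ≤ f ⁅ r ⁆
    marginal≤singleton submod f⊥≈0 {S} {r} r∉S = begin
      f (S ∪ ⁅ r ⁆) - f S  ≤⟨ submod ⊥ S r ⊥⊆ r∉S ⟩
      f (⊥ ∪ ⁅ r ⁆) - f ⊥  ≈⟨ +-cong (reflexive (≡.cong f (∪-identityˡ ⁅ r ⁆))) (-‿cong f⊥≈0) ⟩
      f ⁅ r ⁆ - 0#         ≈⟨ +-identityʳ _ ⟨
      f ⁅ r ⁆ - 0# + 0#    ≈⟨ x-y+y≈x _ 0# ⟩
      f ⁅ r ⁆              ∎

    -- The witness `μ` is the minimal ratio itself. Working with `μ` in place of the curvature gives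
    -- a lower bound on marginals that is multiplied out, hence free of division and valid for
    -- singletons of value zero too.
    curvature-complement : Monotone f → f ⊥ ≈ 0# → ∃ λ μ → curvature f ≡ 1# - μ × 0# ≤ μ ×
      (∀ {S r} → r ∉ S → μ * f ⁅ r ⁆ ≤ f (S ∪ ⁅ r ⁆) - f S)
    curvature-complement mono f⊥≈0 = μ , ≡.refl , μ-nonNegative , μ-bound
      where
      -- Copies of the local definitions in curvature, so that refl applies.
      ratio : Subset n × Fin n → Carrier
      ratio (S , r) = (f (S ∪ ⁅ r ⁆) - f S) / f ⁅ r ⁆

      admissible? : (p : Subset n × Fin n) → let (S , r) = p in Dec (r ∉ S × 0# < f ⁅ r ⁆)
      admissible? (S , r) = ¬? (r ∈? S) ×-dec (0# <? f ⁅ r ⁆)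

      pairs : List (Subset n × Fin n)
      pairs = cartesianProduct (allSubsets n) (allFin n)

      ratios : List Carrier
      ratios = map ratio (filter admissible? pairs)

      μ : Carrier
      μ = minimumOr ≤-totalOrder 1# ratios

      μ-nonNegative : 0# ≤ μ
      -- `0≤1` covers the default value taken when there are no ratios.
      μ-nonNegative = minimumOr-glb ≤-totalOrder {xs = ratios} 0≤1 (All-map⁺ (All.map
        (λ {(S , r)} (_ , 0<fr) → *-nonNegative (marginal-nonNegative mono S r) (0<x⇒0≤x⁻¹ 0<fr))
        (all-filter admissible? pairs)))

      μ≤ratio : ∀ {S r} → r ∉ S → 0# < f ⁅ r ⁆ → μ ≤ ratio (S , r)
      μ≤ratio {S} {r} r∉S 0<fr = minimumOr-≤ ≤-totalOrder 1# {xs = ratios} (∈-map⁺ ratio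
        (∈-filter⁺ admissible? (∈-cartesianProduct⁺ (∈-allSubsets S) (∈-allFin r)) (r∉S , 0<fr)))

      μ-bound : ∀ {S r} → r ∉ S → μ * f ⁅ r ⁆ ≤ f (S ∪ ⁅ r ⁆) - f S
      -- A singleton of value zero contributes no ratio; there the left side vanishes and
      -- monotonicity suffices.
      μ-bound {S} {r} r∉S with f ⁅ r ⁆ ≤.≟ 0#
      ... | yes fr≈0 = begin
        μ * f ⁅ r ⁆          ≈⟨ *-congˡ fr≈0 ⟩
        μ * 0#               ≈⟨ zeroʳ μ ⟩
        0#                   ≤⟨ marginal-nonNegative mono S r ⟩
        f (S ∪ ⁅ r ⁆) - f S  ∎
      ... | no fr≉0 = begin
        μ * f ⁅ r ⁆                              ≤⟨ *-monoʳ-≤-nonNeg 0≤fr (μ≤ratio r∉S (0≤fr , fr≉0 ∘ sym)) ⟩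
        (f (S ∪ ⁅ r ⁆) - f S) / f ⁅ r ⁆ * f ⁅ r ⁆ ≈⟨ x/y*y≈x _ fr≉0 ⟩
        f (S ∪ ⁅ r ⁆) - f S                      ∎
        where
        0≤fr : 0# ≤ f ⁅ r ⁆
        0≤fr = ≤.≤-respˡ-≈ f⊥≈0 (mono ⊥ ⁅ r ⁆ ⊥⊆)

  -- Reassigning resources in a partition.

  module _ {m n : ℕ} where

    insert-∋ : ∀ u r (S : PairSet m n) → r ∈ insert (u , r) S u
    insert-∋ u r S = ≡.subst (r ∈_) (≡.sym (updateAt-updates u S)) (x∈p∪q⁺ (inj₂ (x∈⁅x⁆ r)))

    insert-⊇ : ∀ p (S : PairSet m n) v → S v ⊆ insert p S v
    insert-⊇ (u , r) S v x∈Sv with v ≟ u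
    ... | yes ≡.refl = ≡.subst (_ ∈_) (≡.sym (updateAt-updates u S)) (x∈p∪q⁺ (inj₁ x∈Sv))
    ... | no v≢u     = ≡.subst (_ ∈_) (≡.sym (updateAt-minimal v u S v≢u)) x∈Sv

    ∈-insert⁻ : ∀ {u r} (S : PairSet m n) {v x} → x ∈ insert (u , r) S v → x ∈ S v ⊎ v ≡ u × x ≡ r
    ∈-insert⁻ {u} {r} S {v} x∈ with v ≟ u
    ... | no v≢u     = inj₁ (≡.subst (_ ∈_) (updateAt-minimal v u S v≢u) x∈)
    ... | yes ≡.refl with x∈p∪q⁻ (S u) ⁅ r ⁆ (≡.subst (_ ∈_) (updateAt-updates u S) x∈)
    ...   | inj₁ x∈Su = inj₁ x∈Su
    ...   | inj₂ x∈r  = inj₂ (≡.refl , x∈⁅y⁆⇒x≡y r x∈r)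

    withdraw : Fin n → PairSet m n → PairSet m n
    withdraw r S v = S v ─ ⁅ r ⁆

    reassign : Fin m × Fin n → PairSet m n → PairSet m n
    reassign p S = insert p (withdraw (proj₂ p) S)

    -- The partition `H` of the opening comment, after the picks in `ps`. Histories start with the
    -- latest pick, so the recursion performs the earlier exchanges first.
    hybrid : ∀ {k} → PairSet m n → Vec (Fin m × Fin n) k → PairSet m n
    hybrid Ω []       = Ω
    hybrid Ω (p ∷ ps) = reassign p (hybrid Ω ps)

    reassign-isPartition : ∀ p {S : PairSet m n} → IsPartition S → IsPartition (reassign p S)
    reassign-isPartition (u , r) {S} (alloc , cover) = alloc′ , cover′
      where
      alloc′ : IsAllocation (reassign (u , r) S)
      alloc′ {v} {w} x∈v x∈w with ∈-insert⁻ (withdraw r S) x∈v | ∈-insert⁻ (withdraw r S) x∈w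
      ... | inj₁ x∈v′              | inj₁ x∈w′              = alloc (p─q⊆p _ _ x∈v′) (p─q⊆p _ _ x∈w′)
      -- The resource was withdrawn from every section, so only the newly inserted copy of it
      -- remains.
      ... | inj₁ x∈v′              | inj₂ (_ , ≡.refl)      = contradiction x∈v′ (x∉p─⁅x⁆ (S v))
      ... | inj₂ (_ , ≡.refl)      | inj₁ x∈w′              = contradiction x∈w′ (x∉p─⁅x⁆ (S w))
      ... | inj₂ (≡.refl , _)      | inj₂ (≡.refl , _)      = ≡.refl

      cover′ : ∀ x → ∃ λ v → x ∈ reassign (u , r) S v
      cover′ x with x ≟ r | cover x
      ... | yes ≡.refl | _       = u , insert-∋ u r (withdraw r S)
      ... | no x≢r     | v , x∈v = v , insert-⊇ (u , r) (withdraw r S) v (x∈p∧x∉q⇒x∈p─q x∈v (x≢y⇒x∉⁅y⁆ x≢r))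

  -- Effect of one exchange on the objective.

  module _ {m n : ℕ} (I : Instance m n) where
    open Instance I

    -- Since the resource is not yet allocated in `A`, withdrawing it from `B` takes away nothing
    -- that `A` contains.
    insert⊆reassign : ∀ p {A B : PairSet m n} → Available I A p → (∀ v → A v ⊆ B v) →
                      ∀ v → insert p A v ⊆ reassign p B v
    insert⊆reassign (u , r) {A} {B} r∉A A⊆B v x∈ with ∈-insert⁻ A x∈
    ... | inj₁ x∈Av              = insert-⊇ (u , r) (withdraw r B) v (r∉p∧p⊆q⇒p⊆q─⁅r⁆ (r∉A v) (A⊆B v) x∈Av)
    ... | inj₂ (≡.refl , ≡.refl) = insert-∋ u r (withdraw r B)

    Z-insert : ∀ u r S → Z I S + ρ I (u , r) S ≤ Z I (insert (u , r) S)
    Z-insert u r S = ≤-transfer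
      (sum-mono-≤-except u (λ v v≢u → monotone v _ _ (insert-⊇ (u , r) S v)))
      (begin-equality
        (Z I S + ρ I (u , r) S) + (Z I (insert (u , r) S) + value u (S u))
          ≈⟨ solve 4 (λ x y z w → (x :+ y) :+ (z :+ w) := z :+ (x :+ (y :+ w))) refl _ _ _ _ ⟩
        Z I (insert (u , r) S) + (Z I S + (ρ I (u , r) S + value u (S u)))
          ≈⟨ +-congˡ (+-congˡ (x-y+y≈x _ _)) ⟩
        Z I (insert (u , r) S) + (Z I S + value u (S u ∪ ⁅ r ⁆))
          ≈⟨ +-congˡ (+-congˡ (reflexive (≡.cong (value u) (updateAt-updates u S)))) ⟨
        Z I (insert (u , r) S) + (Z I S + value u (insert (u , r) S u)) ∎)

    ρ-nonNegative : ∀ p S → 0# ≤ ρ I p S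
    ρ-nonNegative (u , r) S = marginal-nonNegative (value u) (monotone u) (S u) r

    Z-nonNegative : ∀ S → 0# ≤ Z I S
    Z-nonNegative S = sum-nonNegative (λ u → ≤.≤-respˡ-≈ (normalised u) (monotone u ⊥ (S u) ⊥⊆))

    ρ≤bestRival : ∀ {u v} r S → v ≢ u → ρ I (v , r) S ≤ bestRival I (u , r) S
    ρ≤bestRival {u} r S v≢u = All.lookup (≤-maximumOr ≤-totalOrder 0# _)
      (∈-map⁺ (λ v → ρ I (v , r) S) (∈-filter⁺ (λ v → ¬? (v ≟ u)) (∈-allFin _) v≢u))

    -- For finite nonzero d, subtracting c = 1 - μ from c + 1/d ≤ 1 + s leaves 1/d ≤ s + μ. The best
    -- rival's marginal is ρ/d, so multiplying by ρ gives the bound.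
    bestRival≤ : ∀ u r S {s μ} → curvature (value u) ≡ 1# - μ → 0# ≤ s → 0# ≤ μ →
                 score I (u , r) S ≤⁺ [ 1# + s ] →
                 bestRival I (u , r) S ≤ (s + μ) * ρ I (u , r) S
    bestRival≤ u r S {s} {μ} c≡1-μ 0≤s 0≤μ with bestRival I (u , r) S ≤.≟ 0#
    -- Here d is infinite, and nonnegativity of the right side is enough.
    ... | yes β≈0 = λ _ → begin
      bestRival I (u , r) S      ≈⟨ β≈0 ⟩
      0#                         ≤⟨ *-nonNegative (≤.≤-respˡ-≈ (+-identityˡ 0#) (+-mono-≤ 0≤s 0≤μ)) (ρ-nonNegative (u , r) S) ⟩
      (s + μ) * ρ I (u , r) S    ∎
    ... | no β≉0 with (ρ I (u , r) S / bestRival I (u , r) S) ≤.≟ 0#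
    -- Here d = 0, so the score is infinite and cannot lie below `[ 1# + s ]`.
    ...   | yes _  = λ ()
    ...   | no d≉0 = λ c+1/d≤1+s → begin
      β                        ≈⟨ *-identityˡ β ⟨
      1# * β                   ≈⟨ *-congʳ (trans (*-comm (d ⁻¹) d) (⁻¹-inverseʳ d≉0)) ⟨
      d ⁻¹ * d * β             ≈⟨ *-assoc (d ⁻¹) d β ⟩
      d ⁻¹ * (d * β)           ≈⟨ *-congˡ (x/y*y≈x _ β≉0) ⟩
      d ⁻¹ * ρ I (u , r) S     ≤⟨ *-monoʳ-≤-nonNeg (ρ-nonNegative (u , r) S) (d⁻¹≤s+μ ([≤]-injective c+1/d≤1+s)) ⟩
      (s + μ) * ρ I (u , r) S  ∎
      where
      β = bestRival I (u , r) S
      d = ρ I (u , r) S / β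

      d⁻¹≤s+μ : curvature (value u) + d ⁻¹ ≤ 1# + s → d ⁻¹ ≤ s + μ
      d⁻¹≤s+μ c+d⁻¹≤1+s = ≤-transfer c+d⁻¹≤1+s (begin-equality
        d ⁻¹ + (1# + s)                ≈⟨ +-congˡ (+-congʳ (x-y+y≈x 1# μ)) ⟨
        d ⁻¹ + (((1# - μ) + μ) + s)    ≈⟨ solve 4 (λ x y z w → x :+ ((y :+ z) :+ w) := (w :+ z) :+ (y :+ x)) refl (d ⁻¹) (1# - μ) μ s ⟩
        (s + μ) + ((1# - μ) + d ⁻¹)    ≈⟨ +-congˡ (+-congʳ (reflexive c≡1-μ)) ⟨
        (s + μ) + (curvature (value u) + d ⁻¹) ∎)

    -- The users other than `v` do not own `r` and keep their sections. For `v`, the lost value is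
    -- the marginal of `r` over `C`, the section with `r` removed; as `C` still contains `A v`,
    -- submodularity bounds it by the marginal over `A v`.
    withdrawal-loss : ∀ {v r} {A B : PairSet m n} → r ∉ A v → A v ⊆ B v → IsAllocation B → r ∈ B v →
                      Z I B ≤ Z I (withdraw r B) + ρ I (v , r) A
    withdrawal-loss {v} {r} {A} {B} r∉Av A⊆B alloc r∈Bv = ≤-transfer (+-mono-≤ others owner)
      (solve 5 (λ x y z w t → x :+ ((y :+ z) :+ (w :+ t)) := (y :+ w) :+ ((x :+ t) :+ z)) refl
        (Z I B) (Z I (withdraw r B)) (value v (B v)) (ρ I (v , r) A) (value v C))
      where
      C = B v ─ ⁅ r ⁆

      others : Z I B + value v C ≤ Z I (withdraw r B) + value v (B v)
      others = sum-mono-≤-except v (λ w w≢v →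
        monotone w _ _ (r∉p∧p⊆q⇒p⊆q─⁅r⁆ (λ r∈Bw → w≢v (alloc r∈Bw r∈Bv)) (λ x∈ → x∈)))

      owner : value v (B v) ≤ ρ I (v , r) A + value v C
      owner = begin
        value v (B v)                                  ≤⟨ monotone v _ _ (p⊆p─⁅r⁆∪⁅r⁆ (B v) r) ⟩
        value v (C ∪ ⁅ r ⁆)                            ≈⟨ x-y+y≈x _ _ ⟨
        (value v (C ∪ ⁅ r ⁆) - value v C) + value v C  ≤⟨ +-monoˡ-≤ _ (submodular v (A v) C r (r∉p∧p⊆q⇒p⊆q─⁅r⁆ r∉Av A⊆B) (x∉p─⁅x⁆ (B v))) ⟩
        ρ I (v , r) A + value v C                      ∎

    reassign-loss : ∀ p {A B : PairSet m n} {s} → 0# ≤ s → score I p A ≤⁺ [ 1# + s ] →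
                    Available I A p → (∀ w → A w ⊆ B w) → IsPartition B →
                    Z I B ≤ Z I (reassign p B) + s * ρ I p A
    reassign-loss (u , r) {A} {B} {s} 0≤s score≤1+s r∉A A⊆B (alloc , cover) with cover r
    ... | v , r∈Bv with v ≟ u
    -- The resource returns to its owner, so no section shrinks; `s` ≥ 0 takes care of the extra
    -- term.
    ...   | yes ≡.refl = begin
      Z I B                                        ≈⟨ +-identityʳ _ ⟨
      Z I B + 0#                                   ≤⟨ +-mono-≤ (sum-mono-≤ (λ w → monotone w _ _ (kept w))) (*-nonNegative 0≤s (ρ-nonNegative (u , r) A)) ⟩
      Z I (reassign (u , r) B) + s * ρ I (u , r) A  ∎
      where
      kept : ∀ w → B w ⊆ reassign (u , r) B w
      kept w {x} x∈Bw with x ≟ r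
      ... | no x≢r     = insert-⊇ (u , r) (withdraw r B) w (x∈p∧x∉q⇒x∈p─q x∈Bw (x≢y⇒x∉⁅y⁆ x≢r))
      ... | yes ≡.refl with alloc x∈Bw r∈Bv
      ...   | ≡.refl = insert-∋ u r (withdraw r B)
    ...   | no v≢u with curvature-complement (value u) (monotone u) (normalised u)
    ...     | μ , c≡1-μ , 0≤μ , μ-bound = begin
      Z I B
        ≤⟨ withdrawal-loss {A = A} {B} (r∉A v) (A⊆B v) alloc r∈Bv ⟩
      Z I C + ρ I (v , r) A
        ≤⟨ +-mono-≤ ≤.refl (≤.trans (ρ≤bestRival r A v≢u) (bestRival≤ u r A c≡1-μ 0≤s 0≤μ score≤1+s)) ⟩
      Z I C + (s + μ) * ρ I (u , r) A
        -- Split the loss: the share with factor `μ` is repaid by what `u` gains, and only the share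
        -- with factor `s` remains.
        ≈⟨ solve 4 (λ x y z w → x :+ (y :+ z) :* w := (x :+ z :* w) :+ y :* w) refl (Z I C) s μ (ρ I (u , r) A) ⟩
      (Z I C + μ * ρ I (u , r) A) + s * ρ I (u , r) A
        ≤⟨ +-monoˡ-≤ _ (+-mono-≤ ≤.refl gain) ⟩
      (Z I C + ρ I (u , r) C) + s * ρ I (u , r) A
        ≤⟨ +-monoˡ-≤ _ (Z-insert u r C) ⟩
      Z I (reassign (u , r) B) + s * ρ I (u , r) A ∎
      where
      C = withdraw r B

      -- Submodularity alone gives no lower bound on the marginal over the larger set. The value of
      -- the singleton serves as a bridge: it dominates the marginal over `A u`, and its multiple by
      -- `μ` lies below the marginal over `C u`.
      gain : μ * ρ I (u , r) A ≤ ρ I (u , r) C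
      gain = ≤.trans
        (*-monoˡ-≤-nonNeg 0≤μ (marginal≤singleton (value u) (submodular u) (normalised u) (r∉A u)))
        (μ-bound (x∉p─⁅x⁆ (B u)))

    selected⇒available : ∀ {index S p} → Selected I index S p → Available I S p
    selected⇒available (((r∉S , _) , _) , _) = r∉S

    unallocated⇒fresh : ∀ {k r} (ps : Vec (Fin m × Fin n) k) → (∀ v → r ∉ chosen I ps v) →
                        VecAll.All (r ≢_) (Vec.map proj₂ ps)
    unallocated⇒fresh []             r∉ = []
    unallocated⇒fresh ((v , x) ∷ ps) r∉ =
      (λ { ≡.refl → r∉ v (insert-∋ v x (chosen I ps)) }) ∷
      unallocated⇒fresh ps (λ w → r∉ w ∘ insert-⊇ (v , x) (chosen I ps) w)

    -- Coverage by the greedy picks.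

    module _ {index : (Fin m × Fin n) ↣ ℕ} where

      picks-unique : ∀ {k} {ps : Vec (Fin m × Fin n) k} → GreedyM I index ps → Unique (Vec.map proj₂ ps)
      picks-unique start = []
      picks-unique (select {p = u , r} {ps} g sel) =
        unallocated⇒fresh ps (selected⇒available {index} sel) ∷ picks-unique g

      -- A missed resource, put in front of the n distinct picked ones, would give n + 1 distinct
      -- elements of `Fin n`.
      greedy-covers : ∀ {ps : Vec (Fin m × Fin n) n} → GreedyM I index ps → ∀ r → ∃ λ v → r ∈ chosen I ps v
      greedy-covers {ps} g r with any? (λ v → r ∈? chosen I ps v)
      ... | yes r∈ = r∈
      ... | no r∉  = contradiction (fresh ∷ picks-unique g) ¬Unique-suc
        where
        fresh : VecAll.All (r ≢_) (Vec.map proj₂ ps)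
        fresh = unallocated⇒fresh ps (λ v r∈ → r∉ (v , r∈))

      -- From the optimal partition to the greedy output.

      module _ {Ω : PairSet m n} (Ω-isPartition : IsPartition Ω) where

        hybrid-isPartition : ∀ {k} (ps : Vec (Fin m × Fin n) k) → IsPartition (hybrid Ω ps)
        hybrid-isPartition []       = Ω-isPartition
        hybrid-isPartition (p ∷ ps) = reassign-isPartition p (hybrid-isPartition ps)

        -- This supplies the inclusion to which submodularity is applied in `withdrawal-loss`. It
        -- persists because each pick is a fresh resource, so no exchange undoes an earlier one.
        chosen⊆hybrid : ∀ {k} {ps : Vec (Fin m × Fin n) k} → GreedyM I index ps →
                        ∀ v → chosen I ps v ⊆ hybrid Ω ps v
        chosen⊆hybrid start v x∈⊥ = contradiction x∈⊥ ∉⊥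
        chosen⊆hybrid (select {p = p} g sel) =
          insert⊆reassign p (selected⇒available {index} sel) (chosen⊆hybrid g)

        -- After n picks each resource has an owner in the greedy set. By `chosen⊆hybrid` that user
        -- owns it in the hybrid as well, and a partition has only one owner per resource.
        hybrid⊆chosen : ∀ {ps : Vec (Fin m × Fin n) n} → GreedyM I index ps →
                        ∀ v → hybrid Ω ps v ⊆ chosen I ps v
        hybrid⊆chosen {ps} g v {x} x∈ with greedy-covers g x
        ... | w , x∈w with proj₁ (hybrid-isPartition ps) x∈ (chosen⊆hybrid g w x∈w)
        ...   | ≡.refl = x∈w

        -- Telescoping over the exchanges: step i costs at most s times its greedy marginal, and
        -- `Z-insert` absorbs these marginals into the value of the greedy set.
        hybrid-bound : ∀ {s k} {ps : Vec (Fin m × Fin n) k} → 0# ≤ s → GreedyM I index ps →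
                       All (_≤⁺ [ 1# + s ]) (scores I ps) →
                       Z I Ω ≤ Z I (hybrid Ω ps) + s * Z I (chosen I ps)
        -- Before any exchange the hybrid is Ω, and the added term is nonnegative.
        hybrid-bound 0≤s start [] =
          ≤.≤-respˡ-≈ (+-identityʳ _) (+-mono-≤ ≤.refl (*-nonNegative 0≤s (Z-nonNegative ∅)))
        hybrid-bound {s} 0≤s (select {p = p} {ps} g sel) (score≤ ∷ scores≤) = begin
          Z I Ω
            ≤⟨ hybrid-bound 0≤s g scores≤ ⟩
          Z I H + s * Z I G
            ≤⟨ +-monoˡ-≤ _ (reassign-loss p 0≤s score≤ (selected⇒available {index} sel) (chosen⊆hybrid g) (hybrid-isPartition ps)) ⟩
          (Z I (reassign p H) + s * ρ I p G) + s * Z I G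
            ≈⟨ solve 4 (λ x y z w → (x :+ y :* z) :+ y :* w := x :+ y :* (w :+ z)) refl (Z I (reassign p H)) s (ρ I p G) (Z I G) ⟩
          Z I (reassign p H) + s * (Z I G + ρ I p G)
            ≤⟨ +-mono-≤ ≤.refl (*-monoˡ-≤-nonNeg 0≤s (Z-insert (proj₁ p) (proj₂ p) G)) ⟩
          Z I (reassign p H) + s * Z I (insert p G) ∎
          where
          H = hybrid Ω ps
          G = chosen I ps

        greedy-bound : ∀ {s} {ps : Vec (Fin m × Fin n) n} → 0# ≤ s → GreedyM I index ps →
                       All (_≤⁺ [ 1# + s ]) (scores I ps) →
                       Z I Ω ≤ (1# + s) * Z I (chosen I ps)
        greedy-bound {s} {ps} 0≤s g scores≤ = begin
          Z I Ω                                       ≤⟨ hybrid-bound 0≤s g scores≤ ⟩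
          Z I (hybrid Ω ps) + s * Z I (chosen I ps)   ≤⟨ +-monoˡ-≤ _ (sum-mono-≤ (λ v → monotone v _ _ (hybrid⊆chosen g v))) ⟩
          Z I (chosen I ps) + s * Z I (chosen I ps)   ≈⟨ +-congʳ (*-identityˡ _) ⟨
          1# * Z I (chosen I ps) + s * Z I (chosen I ps) ≈⟨ distribʳ _ 1# s ⟨
          (1# + s) * Z I (chosen I ps)                ∎

  -- Passage to the ratio with infinity adjoined.

  open TotalOrder ≤⁺-totalOrder using () renaming (trans to ≤⁺-trans)
  open MinOp (Min.minOperator ≤⁺-totalOrder) using (x⊓y≤x; x⊓y≤y)

  -- The hypothesis speaks only of thresholds 1 + s with s ≥ 0, whence the cap at 1. An infinite `M`
  -- has reciprocal 0, and the ratio is nonnegative.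
  [1]⊓1/⁺≤ : ∀ {g ω} M → 0# ≤ g → 0# < ω →
             (∀ {s} → 0# ≤ s → M ≤⁺ [ 1# + s ] → ω ≤ (1# + s) * g) →
             [ 1# ] ⊓⁺ 1/⁺ M ≤⁺ [ g / ω ]
  [1]⊓1/⁺≤ ⊤⁺ 0≤g 0<ω bound =
    ≤⁺-trans (x⊓y≤y [ 1# ] [ 0# ]) [ *-nonNegative 0≤g (0<x⇒0≤x⁻¹ 0<ω) ]
  [1]⊓1/⁺≤ {g} {ω} [ x ] 0≤g 0<ω bound with ≤.total x 1#
  -- Take s = 0; the ratio is then at least 1, whatever the reciprocal of `x`.
  ... | inj₁ x≤1 = ≤⁺-trans (x⊓y≤x [ 1# ] (1/⁺ [ x ])) [ x*z≤y⇒x≤y/z 0<ω (begin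
    1# * ω         ≈⟨ *-identityˡ ω ⟩
    ω              ≤⟨ bound ≤.refl [ ≤.≤-respʳ-≈ (sym (+-identityʳ 1#)) x≤1 ] ⟩
    (1# + 0#) * g  ≈⟨ *-congʳ (+-identityʳ 1#) ⟩
    1# * g         ≈⟨ *-identityˡ g ⟩
    g              ∎) ]
  ... | inj₂ 1≤x with x ≤.≟ 0#
  ...   | yes x≈0 = contradiction (≤.antisym 0≤1 (≤.≤-respʳ-≈ x≈0 1≤x)) 0≉1
  -- Take s = `x - 1#`, so that the threshold is `x` itself.
  ...   | no x≉0  = ≤⁺-trans (x⊓y≤y [ 1# ] [ x ⁻¹ ])
    [ x*z≤y⇒x≤y/z 0<ω (x≤y*z⇒y⁻¹*x≤z (≤.trans 0≤1 1≤x , x≉0 ∘ sym) (begin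
      ω                     ≤⟨ bound (x≤y⇒0≤y-x 1≤x) [ ≤.reflexive (sym 1+[x-1]≈x) ] ⟩
      (1# + (x - 1#)) * g   ≈⟨ *-congʳ 1+[x-1]≈x ⟩
      x * g                 ∎)) ]
    where
    1+[x-1]≈x : 1# + (x - 1#) ≈ x
    1+[x-1]≈x = trans (+-comm 1# _) (x-y+y≈x x 1#)

theorem4 : ∀ {a ℓ₁ ℓ₂} (F : LinearlyOrderedField a ℓ₁ ℓ₂) →
    let open LinearlyOrderedField F
        open SubmodularPartition F
    in
    ∀ {m n : ℕ} → 2 ℕ.≤ m →
    (I : Instance m n) (index : (Fin m × Fin n) ↣ ℕ) →
    (picks : Vec (Fin m × Fin n) n) → GreedyM I index picks →
    (Ω : PairSet m n) → IsOptimalPartition I Ω → 0# < Z I Ω →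
    [ 1# ] ⊓⁺ 1/⁺ maxScore I picks ≤⁺ [ Z I (chosen I picks) / Z I Ω ]
theorem4 F _ I _ picks g _ (Ω-isPartition , _) 0<ZΩ =
  [1]⊓1/⁺≤ (maxScore I picks) (Z-nonNegative I (chosen I picks)) 0<ZΩ
    -- A threshold above the maximum lies above the score of every iteration.
    (λ 0≤s M≤1+s → greedy-bound I Ω-isPartition 0≤s g
      (All.map (λ score≤M → TotalOrder.trans ≤⁺-totalOrder score≤M M≤1+s)
        (≤-maximumOr ≤⁺-totalOrder [ 0# ] (scores I picks))))
  where
  open LinearlyOrderedField F
  open SubmodularPartition F
  open ExchangeArgument F
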